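{- For every $n,m\ge 3$ and every number $t$ of movable tokens per agent, two scattered agents carrying $t$ movable tokens each cannot solve the Black Hole Search (BHS) problem in the oriented $n\times m$ torus containing one black hole, even if the agents have unlimited memory; that is, for every deterministic algorithm (automaton with a possibly infinite state set) there are a position of the black hole and an initial placement of the two agents for which BHS is not solved.
   Context: Network: an anonymous (nodes unlabeled), synchronous, oriented torus of size $n\times m$, $n,m\ge 3$: at each node the four incident edges are consistently marked North, East, South, West. Exactly one node is a black hole: it destroys every agent entering it, leaving no trace. Agents: the anonymous identical agents are scattered, i.e. they start at pairwise distinct nodes, none at the black hole. They follow the same deterministic algorithm, start at the same time in the same initial state, and act synchronously. Each initially carries $t$ identical tokens which can be placed at nodes. Tokens and agents at a node are visible only to agents at the same node; agents can interact only by means of tokens and when they meet at the same node. In each time unit an agent at a node may detect tokens/agents at the node, release or take tokens there, and stay or move to an adjacent node. A token is movable if any agent can pick it up and move it to any node of the network. Formally an agent is a Moore automaton $\mathcal A=(S,S_0,\Sigma,\Lambda,\delta,\phi)$ with state set $S$ (here possibly infinite, i.e. unlimited memory), initial state $S_0$, transition function $\delta:S\times\Sigma\to S$ and output function $\phi:S\to\Lambda$. Elements of $\Sigma$ are quadruples $(D,x,y,b)$: $D\in\{\text{North, South, East, West, none}\}$ is the direction through which the agent arrived at the node, $x$ the number of tokens at the node, $y$ the number of tokens carried by the agent, and $b\in\{\text{true},\text{false}\}$ tells whether at least one other agent is at the node. Elements of $\Lambda$ are quadruples $(P,s,X,M)$: $P\in\{\text{put},\text{pick}\}$ is an action on $s$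 tokens, $X\in\{\text{North, South, East, West, none}\}$ is the edge marked as dangerous, and $M\in\{\text{North, South, East, West, none}\}$ is the move; the token action is performed before the marking, and the marking before the move. A link marked dangerous is permanently disabled. Solving BHS in a given torus: for every position of the black hole and every initial placement of the scattered agents, within finite time all links incident to the black hole, and only those links, are marked dangerous and at least one agent survives. -}

module Defs where

open import Data.Bool.Base using (Bool; true; false; _∨_; if_then_else_)
open import Data.Fin.Base using (Fin; toℕ; opposite)
open import Data.Fin.Patterns using (0F; 1F)
open import Data.Fin.Properties using () renaming (_≟_ to _≟ᶠ_)
open import Data.Maybe using (Maybe; just; nothing; _>>=_; Is-just)
import Data.Maybe as Maybe
open import Data.Nat.Base using (ℕ; zero; suc; _+_; _∸_; _⊓_)
open import Data.Nat.DivMod using (_mod_)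
open import Data.Product.Base using (_×_; _,_; ∃-syntax)
open import Data.Product.Properties using (≡-dec)
open import Function.Bundles using (_⇔_)
open import Level using (Level) renaming (suc to lsuc)
open import Relation.Binary.Definitions using (DecidableEquality)
open import Relation.Binary.PropositionalEquality using (_≡_; _≢_; refl)
open import Relation.Nullary.Decidable.Core using (yes; no; does)

private
  variable
    n m : ℕ
    ℓ : Level

data Direction : Set where
  north east south west : Direction

reverse : Direction → Direction
reverse north = south
reverse east  = west
reverse south = north
reverse west  = east

next : Fin n → Fin n
next {suc k} i = suc (toℕ i) mod suc k

previous : Fin n → Fin n
previous {suc k} i = (toℕ i + k) mod suc k

-- (row , column); rows are numbered northwards and columns eastwards.
Node : ℕ → ℕ → Set
Node n m = Fin n × Fin m

neighbour : Node n m → Direction → Node n m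
neighbour (i , j) north = next i , j
neighbour (i , j) east  = i , next j
neighbour (i , j) south = previous i , j
neighbour (i , j) west  = i , previous j

data Axis : Set where
  vertical horizontal : Axis

-- Undirected edges: (v , vertical) joins v to its northern neighbour and
-- (v , horizontal) joins v to its eastern neighbour.
Link : ℕ → ℕ → Set
Link n m = Node n m × Axis

link : Node n m → Direction → Link n m
link v north = v , vertical
link v east  = v , horizontal
link v south = neighbour v south , vertical
link v west  = neighbour v west , horizontal

_≟ⁿ_ : DecidableEquality (Node n m)
_≟ⁿ_ = ≡-dec _≟ᶠ_ _≟ᶠ_

_≟ᵃ_ : DecidableEquality Axis
vertical   ≟ᵃ vertical   = yes refl
vertical   ≟ᵃ horizontal = no λ ()
horizontal ≟ᵃ vertical   = no λ ()
horizontal ≟ᵃ horizontal = yes refl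

_≟ˡ_ : DecidableEquality (Link n m)
_≟ˡ_ = ≡-dec _≟ⁿ_ _≟ᵃ_

record Input : Set where
  field
    -- The port of the current node through which the agent has just entered
    -- it (an agent that moved east enters through west); nothing if the agent
    -- has not moved in the last time unit.
    arrival       : Maybe Direction
    tokensAtNode  : ℕ
    tokensCarried : ℕ
    company       : Bool

data TokenAction : Set where
  put pick : ℕ → TokenAction

record Output : Set where
  field
    tokenAction : TokenAction
    mark        : Maybe Direction
    move        : Maybe Direction

record Algorithm ℓ : Set (lsuc ℓ) where
  field
    State : Set ℓ
    start : State
    δ     : State → Input → State
    φ     : State → Output

record Agent (State : Set ℓ) (n m : ℕ) : Set ℓ where
  field
    position : Node n m
    memory   : State
    carried  : ℕ
    entry    : Maybe Direction

record World (State : Set ℓ) (n m : ℕ) : Set ℓ where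
  field
    -- nothing: the agent has been destroyed.
    agents : Fin 2 → Maybe (Agent State n m)
    tokens : Node n m → ℕ
    marked : Link n m → Bool

update : ∀ {a b} {A : Set a} {B : Set b} →
         DecidableEquality A → A → B → (A → B) → A → B
update _≟_ x y f z = if does (z ≟ x) then y else f z

-- From the numbers of tokens carried and lying at the node to the new numbers.
-- A request exceeding what is available is served as far as possible.
transfer : TokenAction → ℕ → ℕ → ℕ × ℕ
transfer (put s)  c h = c ∸ (s ⊓ c) , h + (s ⊓ c)
transfer (pick s) c h = c + (s ⊓ h) , h ∸ (s ⊓ h)

-- Two agents at the same node may compete for the tokens lying there. A tie
-- break selects, in each configuration, the agent whose token action is carried
-- out first; it has no effect when the agents are at different nodes.
TieBreak : Algorithm ℓ → ℕ → ℕ → Set ℓ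
TieBreak A n m = World (Algorithm.State A) n m → Fin 2

record Placement (n m : ℕ) (blackHole : Node n m) : Set where
  field
    home      : Fin 2 → Node n m
    scattered : home 0F ≢ home 1F
    safe      : ∀ i → home i ≢ blackHole

module Execution {n m : ℕ} (t : ℕ) (A : Algorithm ℓ) (first : TieBreak A n m)
                 (blackHole : Node n m) where
  open Algorithm A
  open Agent
  open World
  open Output

  initial : Placement n m blackHole → World State n m
  initial p = record
    { agents = λ i → just (record
        { position = Placement.home p i
        ; memory   = start
        ; carried  = t
        ; entry    = nothing
        })
    ; tokens = λ _ → 0
    ; marked = λ _ → false
    }

  -- One time unit: token actions, then markings, then moves, each phase
  -- being completed by both agents before the next one begins; afterwards both
  -- agents read their inputs and change state.

  useTokens : Fin 2 → World State n m → World State n m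
  useTokens i w = Maybe.maybe′ act w (agents w i)
    where
    act : Agent State n m → World State n m
    act a =
      let c , h = transfer (tokenAction (φ (memory a)))
                           (carried a) (tokens w (position a))
      in record w
        { agents = update _≟ᶠ_ i (just (record a { carried = c })) (agents w)
        ; tokens = update _≟ⁿ_ (position a) h (tokens w)
        }

  marks : Maybe (Agent State n m) → Link n m → Bool
  marks nothing  e = false
  marks (just a) e =
    Maybe.maybe′ (λ d → does (e ≟ˡ link (position a) d)) false
                 (mark (φ (memory a)))

  markLinks : World State n m → World State n m
  markLinks w = record w
    { marked = λ e → marked w e ∨ marks (agents w 0F) e ∨ marks (agents w 1F) e }

  -- A marked link cannot be traversed: an agent trying to do so stays put.
  moveAlong : (Link n m → Bool) → Agent State n m →
              Maybe Direction → Maybe (Agent State n m)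
  moveAlong disabled a nothing  = just (record a { entry = nothing })
  moveAlong disabled a (just d) =
    if disabled (link (position a) d)
    then just (record a { entry = nothing })
    else if does (neighbour (position a) d ≟ⁿ blackHole)
    then nothing
    else just (record a { position = neighbour (position a) d
                        ; entry    = just (reverse d) })

  moveAgents : World State n m → World State n m
  moveAgents w = record w
    { agents = λ i → agents w i >>= λ a →
        moveAlong (marked w) a (move (φ (memory a))) }

  isAt : Node n m → Maybe (Agent State n m) → Bool
  isAt v nothing  = false
  isAt v (just a) = does (position a ≟ⁿ v)

  -- On Fin 2, opposite i is the other agent.
  input : World State n m → Fin 2 → Agent State n m → Input
  input w i a = record
    { arrival       = entry a
    ; tokensAtNode  = tokens w (position a)
    ; tokensCarried = carried a
    ; company       = isAt (position a) (agents w (opposite i))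
    }

  sense : World State n m → World State n m
  sense w = record w
    { agents = λ i →
        Maybe.map (λ a → record a { memory = δ (memory a) (input w i a) })
                  (agents w i)
    }

  step : World State n m → World State n m
  step w = sense (moveAgents (markLinks
             (useTokens (opposite (first w)) (useTokens (first w) w))))

  -- The initial state already determines the actions of the first time unit;
  -- inputs are read from the end of that time unit on.
  world : Placement n m blackHole → ℕ → World State n m
  world p zero    = initial p
  world p (suc T) = step (world p T)

  Solved : World State n m → Set ℓ
  Solved w =
    (∀ e → marked w e ≡ true ⇔ (∃[ d ] e ≡ link blackHole d))
    × (∃[ i ] Is-just (agents w i))

SolvedFrom : (t : ℕ) (A : Algorithm ℓ) → TieBreak A n m →
             (blackHole : Node n m) → Placement n m blackHole → Set ℓ
SolvedFrom t A first blackHole p = ∃[ T ] Solved (world p T)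
  where open Execution t A first blackHole

SolvesBHS : (n m t : ℕ) (A : Algorithm ℓ) → TieBreak A n m → Set ℓ
SolvesBHS n m t A first =
  (blackHole : Node n m) (p : Placement n m blackHole) →
  SolvedFrom t A first blackHole p

{-# OPTIONS --safe #-}

-- Let d be the direction of the first move of an agent and follow an agent
-- walking alone from o in a torus without black hole. Choose a ring in direction
-- d that avoids o, and put the black hole b on it and the other agent at the
-- node x from which a move in direction d enters b. Until its first move the
-- other agent behaves exactly like the agent at o; then it dies, and all it
-- leaves behind lies at x. So the agent from o walks as if alone until it enters
-- the ring, and cannot mark the link at b in direction d before that. If it
-- never enters the ring, that link is never marked; if it does, let b be the
-- first node of the ring that it enters, and it dies there as well.
-- An agent that marks a link at or before its first move, or that does neither
-- for ever, fails for any black hole that shares no link with its home.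
module Submission where

open import Defs
open import Axiom.ExcludedMiddle using (ExcludedMiddle)
open import Data.Bool.Base using (Bool; true; false; _∨_; if_then_else_)
open import Data.Bool.Properties using (∨-identityʳ; ∨-zeroʳ)
open import Data.Empty using (⊥-elim)
open import Data.Fin.Base using (Fin; toℕ; opposite)
open import Data.Fin.Patterns using (0F; 1F)
open import Data.Fin.Properties using (toℕ-injective; toℕ-fromℕ<; toℕ<n) renaming (_≟_ to _≟ᶠ_)
open import Data.Maybe using (Maybe; just; nothing; _>>=_; Is-just; maybe′)
import Data.Maybe as Maybe
open import Data.Nat.Base using (ℕ; zero; suc; _+_; _∸_; _≤_; _<_; z≤n; s≤s)
open import Data.Nat.DivMod using (_%_; _mod_; m%n<n; m%n%n≡m%n; %-distribˡ-+; m<n⇒m%n≡m; [m+n]%n≡m%n; n%n≡0)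
open import Data.Nat.Properties using
  ( +-comm; +-suc; 1+n≢n; m∸n+n≡m; n≤1+n; ≤-refl; ≤-trans; ≤-<-connex
  ; m≤n⇒m<n∨m≡n; m<1+n⇒m<n∨m≡n; m<n⇒m<1+n )
open import Data.Product.Base using (_×_; Σ-syntax; ∃-syntax; _,_; proj₁; proj₂)
open import Data.Sum.Base using (_⊎_; inj₁; inj₂; [_,_]′)
open import Function.Base using (_∘_; id)
open import Function.Bundles using (Equivalence)
open import Level using (Level; Lift; lift; lower)
open import Relation.Binary.Definitions using (DecidableEquality)
open import Relation.Binary.PropositionalEquality using (_≡_; _≢_; refl; sym; trans; cong; cong₂; subst; ≢-sym; module ≡-Reasoning)
open import Relation.Nullary.Decidable.Core using (Dec; yes; no; does; map′; ¬?; _×-dec_; decidable-stable; ¬¬-excluded-middle)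
open import Relation.Nullary.Decidable using (dec-true; dec-false)
open import Relation.Nullary.Negation.Core using (¬_)
open import Relation.Unary using (Pred; Decidable)

private
  variable
    ℓ : Level
    n m : ℕ

-- Least witnesses and point updates.

least : ∀ {p} {P : Pred ℕ p} → Decidable P → ∀ {k} → P k →
        ∃[ j ] P j × (∀ {i} → i < j → ¬ P i)
least {P = P} P? {k} Pk with below k
  where
  below : ∀ k → (∃[ j ] P j × (∀ {i} → i < j → ¬ P i)) ⊎ (∀ {i} → i < k → ¬ P i)
  below zero = inj₂ λ ()
  below (suc k) with below k
  ... | inj₁ found = inj₁ found
  ... | inj₂ none with P? k
  ...   | yes Pk = inj₁ (k , Pk , none)
  ...   | no ¬Pk = inj₂ λ i<1+k →
    [ none , (λ { refl → ¬Pk }) ]′ (m<1+n⇒m<n∨m≡n i<1+k)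
... | inj₁ found = found
... | inj₂ none  = k , Pk , none

module _ {a b} {A : Set a} {B : Set b} (_≟_ : DecidableEquality A)
         (x : A) (y : B) (f : A → B) where

  update-≡ : update _≟_ x y f x ≡ y
  update-≡ rewrite dec-true (x ≟ x) refl = refl

  update-≢ : ∀ {z} → z ≢ x → update _≟_ x y f z ≡ f z
  update-≢ {z} z≢x rewrite dec-false (z ≟ x) z≢x = refl

-- Arithmetic of the cyclic coordinates.

toℕ-mod : ∀ a {k} → toℕ (a mod suc k) ≡ a % suc k
toℕ-mod a {k} = toℕ-fromℕ< (m%n<n a (suc k))

[m+n%d]%d≡[m+n]%d : ∀ m n k → (m + n % suc k) % suc k ≡ (m + n) % suc k
[m+n%d]%d≡[m+n]%d m n k = begin
  (m + n % d) % d             ≡⟨ %-distribˡ-+ m (n % d) d ⟩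
  (m % d + n % d % d) % d     ≡⟨ cong (λ z → (m % d + z) % d) (m%n%n≡m%n n d) ⟩
  (m % d + n % d) % d         ≡⟨ %-distribˡ-+ m n d ⟨
  (m + n) % d                 ∎
  where
  open ≡-Reasoning
  d = suc k

toℕ+n%n : ∀ {k} (i : Fin (suc k)) → (toℕ i + suc k) % suc k ≡ toℕ i
toℕ+n%n {k} i = trans ([m+n]%n≡m%n (toℕ i) (suc k)) (m<n⇒m%n≡m (toℕ<n i))

next-previous : (i : Fin n) → next (previous i) ≡ i
next-previous {suc k} i = toℕ-injective (begin
  toℕ (next (previous i))            ≡⟨ toℕ-mod (suc (toℕ (previous i))) {k} ⟩
  suc (toℕ (previous i)) % d         ≡⟨ cong (λ z → suc z % d) (toℕ-mod (toℕ i + k) {k}) ⟩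
  (1 + (toℕ i + k) % d) % d          ≡⟨ [m+n%d]%d≡[m+n]%d 1 (toℕ i + k) k ⟩
  suc (toℕ i + k) % d                ≡⟨ cong (_% d) (+-suc (toℕ i) k) ⟨
  (toℕ i + d) % d                    ≡⟨ toℕ+n%n i ⟩
  toℕ i                              ∎)
  where
  open ≡-Reasoning
  d = suc k

previous-next : (i : Fin n) → previous (next i) ≡ i
previous-next {suc k} i = toℕ-injective (begin
  toℕ (previous (next i))            ≡⟨ toℕ-mod (toℕ (next i) + k) {k} ⟩
  (toℕ (next i) + k) % d             ≡⟨ cong (λ z → (z + k) % d) (toℕ-mod (suc (toℕ i)) {k}) ⟩
  (suc (toℕ i) % d + k) % d          ≡⟨ cong (_% d) (+-comm (suc (toℕ i) % d) k) ⟩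
  (k + suc (toℕ i) % d) % d          ≡⟨ [m+n%d]%d≡[m+n]%d k (suc (toℕ i)) k ⟩
  (k + suc (toℕ i)) % d              ≡⟨ cong (_% d) (+-comm k (suc (toℕ i))) ⟩
  (suc (toℕ i) + k) % d              ≡⟨ cong (_% d) (+-suc (toℕ i) k) ⟨
  (toℕ i + d) % d                    ≡⟨ toℕ+n%n i ⟩
  toℕ i                              ∎)
  where
  open ≡-Reasoning
  d = suc k

-- Below the last index the successor is not reduced; at the last index it wraps to 0, and a fixed
-- point there would force side length 1.
next≢ : (i : Fin (2 + n)) → next i ≢ i
next≢ {n} i eq = [ below , top ]′ (m≤n⇒m<n∨m≡n (toℕ<n i))
  where
  suc%≡ : suc (toℕ i) % (2 + n) ≡ toℕ i
  suc%≡ = trans (sym (toℕ-mod (suc (toℕ i)))) (cong toℕ eq)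
  below : ¬ suc (toℕ i) < 2 + n
  below lt = 1+n≢n (trans (sym (m<n⇒m%n≡m lt)) suc%≡)
  top : suc (toℕ i) ≢ 2 + n
  top e with trans (sym (n%n≡0 (2 + n))) (trans (cong (_% (2 + n)) (sym e)) suc%≡)
  ... | 0≡i with trans (cong suc 0≡i) e
  ... | ()

-- Nodes, links and rings of the torus.

neighbour-reverse : (v : Node n m) (d : Direction) →
                    neighbour (neighbour v (reverse d)) d ≡ v
neighbour-reverse (i , j) north = cong (_, j) (next-previous i)
neighbour-reverse (i , j) east  = cong (i ,_) (next-previous j)
neighbour-reverse (i , j) south = cong (_, j) (previous-next i)
neighbour-reverse (i , j) west  = cong (i ,_) (previous-next j)

neighbour≢ : (v : Node (2 + n) (2 + m)) (d : Direction) → neighbour v d ≢ v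
neighbour≢ (i , j) north eq = next≢ i (cong proj₁ eq)
neighbour≢ (i , j) east  eq = next≢ j (cong proj₂ eq)
neighbour≢ (i , j) south eq =
  next≢ i (trans (cong next (sym (cong proj₁ eq))) (next-previous i))
neighbour≢ (i , j) west  eq =
  next≢ j (trans (cong next (sym (cong proj₂ eq))) (next-previous j))

-- A vertical link keeps the column of its ends and a horizontal one the row; links of different
-- axes are never equal. Nodes differing in both coordinates therefore share no link.
link-aligned : (u v : Node n m) (d e : Direction) → link u d ≡ link v e →
               proj₁ u ≡ proj₁ v ⊎ proj₂ u ≡ proj₂ v
link-aligned u v north north eq = inj₂ (cong (proj₂ ∘ proj₁) eq)
link-aligned u v north south eq = inj₂ (cong (proj₂ ∘ proj₁) eq)
link-aligned u v south north eq = inj₂ (cong (proj₂ ∘ proj₁) eq)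
link-aligned u v south south eq = inj₂ (cong (proj₂ ∘ proj₁) eq)
link-aligned u v east  east  eq = inj₁ (cong (proj₁ ∘ proj₁) eq)
link-aligned u v east  west  eq = inj₁ (cong (proj₁ ∘ proj₁) eq)
link-aligned u v west  east  eq = inj₁ (cong (proj₁ ∘ proj₁) eq)
link-aligned u v west  west  eq = inj₁ (cong (proj₁ ∘ proj₁) eq)

-- The ring in direction d through (1 , 1).
OnRing : Direction → Node (2 + n) (2 + m) → Set
OnRing north (i , j) = j ≡ 1F
OnRing east  (i , j) = i ≡ 1F
OnRing south (i , j) = j ≡ 1F
OnRing west  (i , j) = i ≡ 1F

onRing? : (d : Direction) (v : Node (2 + n) (2 + m)) → Dec (OnRing d v)
onRing? north (i , j) = j ≟ᶠ 1F
onRing? east  (i , j) = i ≟ᶠ 1F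
onRing? south (i , j) = j ≟ᶠ 1F
onRing? west  (i , j) = i ≟ᶠ 1F

-- They differ in both coordinates, so for every `d` the ring through `corner` misses `origin`.
origin corner : Node (2 + n) (2 + m)
origin = 0F , 0F
corner = 1F , 1F

corner-onRing : ∀ d → OnRing d (corner {n} {m})
corner-onRing north = refl
corner-onRing east  = refl
corner-onRing south = refl
corner-onRing west  = refl

origin-offRing : ∀ d → ¬ OnRing d (origin {n} {m})
origin-offRing north ()
origin-offRing east  ()
origin-offRing south ()
origin-offRing west  ()

-- A move in direction `d` preserves the transverse coordinate, which cuts out the ring. So the
-- first move of the walk cannot enter it.
neighbour-offRing : ∀ d (v : Node (2 + n) (2 + m)) → ¬ OnRing d v →
                    ¬ OnRing d (neighbour v d)
neighbour-offRing north v off = off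
neighbour-offRing east  v off = off
neighbour-offRing south v off = off
neighbour-offRing west  v off = off

reverse-onRing : ∀ d (v : Node (2 + n) (2 + m)) → OnRing d v →
                 OnRing d (neighbour v (reverse d))
reverse-onRing north v on = on
reverse-onRing east  v on = on
reverse-onRing south v on = on
reverse-onRing west  v on = on

-- Both ends of a link in direction `d` share the transverse coordinate. An agent off the ring
-- therefore cannot mark a link lying along it.
link-onRing : ∀ d e (u v : Node (2 + n) (2 + m)) → link v d ≡ link u e →
              OnRing d v → OnRing d u
link-onRing north north u v eq on = trans (sym (cong (proj₂ ∘ proj₁) eq)) on
link-onRing north south u v eq on = trans (sym (cong (proj₂ ∘ proj₁) eq)) on
link-onRing south north u v eq on = trans (sym (cong (proj₂ ∘ proj₁) eq)) on
link-onRing south south u v eq on = trans (sym (cong (proj₂ ∘ proj₁) eq)) on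
link-onRing east  east  u v eq on = trans (sym (cong (proj₁ ∘ proj₁) eq)) on
link-onRing east  west  u v eq on = trans (sym (cong (proj₁ ∘ proj₁) eq)) on
link-onRing west  east  u v eq on = trans (sym (cong (proj₁ ∘ proj₁) eq)) on
link-onRing west  west  u v eq on = trans (sym (cong (proj₁ ∘ proj₁) eq)) on

-- One agent alone in a torus without black hole.

record Solo (State : Set ℓ) (n m : ℕ) : Set ℓ where
  field
    self   : Agent State n m
    tokens : Node n m → ℕ
    marked : Link n m → Bool

module SoloRun {n m : ℕ} (t : ℕ) (A : Algorithm ℓ) where
  open Algorithm A
  open Agent
  open Solo
  open Output

  output : Solo State n m → Output
  output s = φ (memory (self s))

  soloTokens : Solo State n m → Solo State n m
  soloTokens s =
    let c , h = transfer (tokenAction (output s))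
                         (carried (self s)) (tokens s (position (self s)))
    in record s { self   = record (self s) { carried = c }
                ; tokens = update _≟ⁿ_ (position (self s)) h (tokens s) }

  ownMark : Solo State n m → Link n m → Bool
  ownMark s e =
    maybe′ (λ d → does (e ≟ˡ link (position (self s)) d)) false (mark (output s))

  soloMark : Solo State n m → Solo State n m
  soloMark s = record s { marked = λ e → marked s e ∨ ownMark s e }

  stride : (Link n m → Bool) → Agent State n m → Maybe Direction → Agent State n m
  stride disabled a nothing  = record a { entry = nothing }
  stride disabled a (just d) =
    if disabled (link (position a) d)
    then record a { entry = nothing }
    else record a { position = neighbour (position a) d ; entry = just (reverse d) }

  soloMove : Solo State n m → Solo State n m
  soloMove s = record s { self = stride (marked s) (self s) (move (output s)) }

  soloInput : Solo State n m → Input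
  soloInput s = record
    { arrival       = entry (self s)
    ; tokensAtNode  = tokens s (position (self s))
    ; tokensCarried = carried (self s)
    -- Under the coupling below nobody is ever met: the twins stand apart, and later agent 0 is
    -- destroyed.
    ; company       = false
    }

  soloSense : Solo State n m → Solo State n m
  soloSense s = record s
    { self = record (self s) { memory = δ (memory (self s)) (soloInput s) } }

  soloStep : Solo State n m → Solo State n m
  soloStep s = soloSense (soloMove (soloMark (soloTokens s)))

  solo : Node n m → ℕ → Solo State n m
  solo o zero    = record
    { self   = record { position = o ; memory = start ; carried = t ; entry = nothing }
    ; tokens = λ _ → 0
    ; marked = λ _ → false
    }
  solo o (suc T) = soloStep (solo o T)

  -- Token actions are allowed: each twin handles a pile of its own, so they do not disturb the
  -- coupling.
  Quiet : Solo State n m → Set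
  Quiet s = mark (output s) ≡ nothing × move (output s) ≡ nothing

  quiet? : ∀ s → Dec (Quiet s)
  quiet? s = none? (mark (output s)) ×-dec none? (move (output s))
    where
    none? : (d : Maybe Direction) → Dec (d ≡ nothing)
    none? nothing  = yes refl
    none? (just d) = no λ ()

  unmarked-step : ∀ s e → (∀ d → e ≢ link (position (self s)) d) →
                  marked s e ≡ false → marked (soloStep s) e ≡ false
  unmarked-step s e away unmarked with mark (output s)
  ... | nothing = trans (∨-identityʳ _) unmarked
  ... | just d rewrite unmarked = dec-false (e ≟ˡ _) (away d)

  departs : ∀ s {d} → mark (output s) ≡ nothing → move (output s) ≡ just d →
            marked s (link (position (self s)) d) ≡ false →
            position (self (soloStep s)) ≡ neighbour (position (self s)) d
  departs s silent go free rewrite go | silent | free = refl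

  -- Coupling of the two-agent run with the solo run.

  module Shadow (first : TieBreak A n m) (b x : Node n m) where
    open Execution t A first b
    open World renaming (tokens to tokensʷ; marked to markedʷ)

    ghost : Agent State n m → Agent State n m
    ghost a = record a { position = x }

    -- Agent 1 is the solo agent of s′ and agent 0 is that of s, displaced to
    -- x; s and s′ differ only while the two agents handle tokens in turn.
    record Twins (w : World State n m) (s s′ : Solo State n m) : Set ℓ where
      field
        agent0   : agents w 0F ≡ just (ghost (self s))
        agent1   : agents w 1F ≡ just (self s′)
        apart    : position (self s′) ≢ x
        tokensAt : tokensʷ w x ≡ tokens s (position (self s))
        tokens≡  : ∀ v → v ≢ x → tokensʷ w v ≡ tokens s′ v
        marked≡  : ∀ e → markedʷ w e ≡ marked s′ e

    -- Agent 0 may have left tokens at `x`, so the piles are compared only elsewhere; off `x` the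
    -- remaining agent cannot notice the difference.
    record Alone (w : World State n m) (s : Solo State n m) : Set ℓ where
      field
        agent0   : agents w 0F ≡ nothing
        agent1   : agents w 1F ≡ just (self s)
        apart    : position (self s) ≢ x
        tokens≡  : ∀ v → v ≢ x → tokensʷ w v ≡ tokens s v
        marked≡  : ∀ e → markedʷ w e ≡ marked s e

    record Dead (w : World State n m) : Set ℓ where
      field
        agent0 : agents w 0F ≡ nothing
        agent1 : agents w 1F ≡ nothing

    useTokens-just : ∀ {w i a} → agents w i ≡ just a →
      let c , h = transfer (tokenAction (φ (memory a))) (carried a) (tokensʷ w (position a))
      in useTokens i w ≡ record w
           { agents = update _≟ᶠ_ i (just (record a { carried = c })) (agents w)
           ; tokens = update _≟ⁿ_ (position a) h (tokensʷ w) }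
    useTokens-just eq rewrite eq = refl

    useTokens-nothing : ∀ {w i} → agents w i ≡ nothing → useTokens i w ≡ w
    useTokens-nothing eq rewrite eq = refl

    useTokens-marked : ∀ w i e → markedʷ (useTokens i w) e ≡ markedʷ w e
    useTokens-marked w i e with agents w i
    ... | nothing = refl
    ... | just _  = refl

    marked-step : ∀ w e → markedʷ w e ≡ true → markedʷ (step w) e ≡ true
    marked-step w e eq
      rewrite useTokens-marked (useTokens (first w) w) (opposite (first w)) e
            | useTokens-marked w (first w) e
            | eq = refl

    marked-stays : ∀ p T k e → markedʷ (world p T) e ≡ true →
                   markedʷ (world p (k + T)) e ≡ true
    marked-stays p T zero    e eq = eq
    marked-stays p T (suc k) e eq =
      marked-step (world p (k + T)) e (marked-stays p T k e eq)

    -- The coupling through the phases of a time unit.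

    twins-use0 : ∀ {w s s′} → Twins w s s′ → Twins (useTokens 0F w) (soloTokens s) s′
    twins-use0 {w} {s} {s′} tw
      rewrite useTokens-just {w} {0F} (Twins.agent0 tw) | Twins.tokensAt tw = record
      { agent0   = refl
      ; agent1   = agent1
      ; apart    = apart
      ; tokensAt = trans (update-≡ _≟ⁿ_ x _ (tokensʷ w))
                         (sym (update-≡ _≟ⁿ_ (position (self s)) _ (tokens s)))
      ; tokens≡  = λ v v≢x → trans (update-≢ _≟ⁿ_ x _ (tokensʷ w) v≢x) (tokens≡ v v≢x)
      ; marked≡  = marked≡
      }
      where open Twins tw

    update-cong : ∀ (u : Node n m) h (f g : Node n m → ℕ) v → f v ≡ g v →
                  update _≟ⁿ_ u h f v ≡ update _≟ⁿ_ u h g v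
    update-cong u h f g v eq = cong (if does (v ≟ⁿ u) then h else_) eq

    twins-use1 : ∀ {w s s′} → Twins w s s′ → Twins (useTokens 1F w) s (soloTokens s′)
    twins-use1 {w} {s} {s′} tw
      rewrite useTokens-just {w} {1F} (Twins.agent1 tw)
            | Twins.tokens≡ tw (position (self s′)) (Twins.apart tw) = record
      { agent0   = agent0
      ; agent1   = refl
      ; apart    = apart
      ; tokensAt = trans (update-≢ _≟ⁿ_ (position (self s′)) _ (tokensʷ w) (≢-sym apart)) tokensAt
      ; tokens≡  = λ v v≢x → update-cong (position (self s′)) _ (tokensʷ w) (tokens s′) v (tokens≡ v v≢x)
      ; marked≡  = marked≡
      }
      where open Twins tw

    -- The two piles lie at different nodes, so the token actions are independent and the tie break
    -- has no influence.
    twins-use : ∀ i {w s} → Twins w s s →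
                Twins (useTokens (opposite i) (useTokens i w)) (soloTokens s) (soloTokens s)
    twins-use 0F tw = twins-use1 (twins-use0 tw)
    twins-use 1F tw = twins-use0 (twins-use1 tw)

    alone-use1 : ∀ {w s} → Alone w s → Alone (useTokens 1F w) (soloTokens s)
    alone-use1 {w} {s} al
      rewrite useTokens-just {w} {1F} (Alone.agent1 al)
            | Alone.tokens≡ al (position (self s)) (Alone.apart al) = record
      { agent0   = agent0
      ; agent1   = refl
      ; apart    = apart
      ; tokens≡  = λ v v≢x → update-cong (position (self s)) _ (tokensʷ w) (tokens s) v (tokens≡ v v≢x)
      ; marked≡  = marked≡
      }
      where open Alone al

    alone-use : ∀ i {w s} → Alone w s →
                Alone (useTokens (opposite i) (useTokens i w)) (soloTokens s)
    alone-use 0F {w} al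
      rewrite useTokens-nothing {w} {0F} (Alone.agent0 al) = alone-use1 al
    alone-use 1F {w} al with alone-use1 al
    ... | al′ rewrite useTokens-nothing {useTokens 1F w} {0F} (Alone.agent0 al′) = al′

    -- Silence is assumed because a mark made by agent 0 at `x` would have no counterpart in the
    -- solo run.
    twins-mark : ∀ {w s} → Twins w s s → mark (output s) ≡ nothing →
                 Twins (markLinks w) (soloMark s) (soloMark s)
    twins-mark {w} {s} tw silent = record
      { agent0   = agent0
      ; agent1   = agent1
      ; apart    = apart
      ; tokensAt = tokensAt
      ; tokens≡  = tokens≡
      ; marked≡  = marked′
      }
      where
      open Twins tw
      marked′ : ∀ e → markedʷ (markLinks w) e ≡ marked (soloMark s) e
      marked′ e rewrite agent0 | agent1 | silent | marked≡ e = refl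

    alone-mark : ∀ {w s} → Alone w s → Alone (markLinks w) (soloMark s)
    alone-mark {w} {s} al = record
      { agent0   = agent0
      ; agent1   = agent1
      ; apart    = apart
      ; tokens≡  = tokens≡
      ; marked≡  = marked′
      }
      where
      open Alone al
      marked′ : ∀ e → markedʷ (markLinks w) e ≡ marked (soloMark s) e
      marked′ e rewrite agent0 | agent1 | marked≡ e = refl

    moveAlong-safe : ∀ {disabled disabled′} a d → (∀ e → disabled e ≡ disabled′ e) →
                     position (stride disabled′ a d) ≢ b →
                     moveAlong disabled a d ≡ just (stride disabled′ a d)
    moveAlong-safe a nothing  eq safe = refl
    moveAlong-safe {disabled′ = disabled′} a (just d) eq safe
      rewrite eq (link (position a) d) with disabled′ (link (position a) d)
    ... | true  = refl
    ... | false rewrite dec-false (neighbour (position a) d ≟ⁿ b) safe = refl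

    -- Staying put would leave the agent off `b`, so an arrival at `b` comes from an actual
    -- crossing.
    moveAlong-fatal : ∀ {disabled disabled′} a d → (∀ e → disabled e ≡ disabled′ e) →
                      position a ≢ b → position (stride disabled′ a d) ≡ b →
                      moveAlong disabled a d ≡ nothing
    moveAlong-fatal a nothing  eq a≢b hit = ⊥-elim (a≢b hit)
    moveAlong-fatal {disabled′ = disabled′} a (just d) eq a≢b hit
      rewrite eq (link (position a) d) with disabled′ (link (position a) d)
    ... | true  = ⊥-elim (a≢b hit)
    ... | false rewrite dec-true (neighbour (position a) d ≟ⁿ b) hit = refl

    twins-rest : ∀ {w s} → Twins w s s → move (output s) ≡ nothing →
                 Twins (moveAgents w) (soloMove s) (soloMove s)
    twins-rest {w} {s} tw still = record
      { agent0   = trans (rest agent0) (cong (just ∘ ghost) (sym rested))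
      ; agent1   = trans (rest agent1) (cong just (sym rested))
      ; apart    = subst (λ a → position a ≢ x) (sym rested) apart
      ; tokensAt = subst (λ a → tokensʷ w x ≡ tokens s (position a)) (sym rested) tokensAt
      ; tokens≡  = tokens≡
      ; marked≡  = marked≡
      }
      where
      open Twins tw
      rested : self (soloMove s) ≡ record (self s) { entry = nothing }
      rested = cong (stride (marked s) (self s)) still
      rest : ∀ {i p} → agents w i ≡ just (record (self s) { position = p }) →
             agents (moveAgents w) i ≡ just (record (self s) { position = p ; entry = nothing })
      rest eq rewrite eq | still = refl

    twins-split : ∀ {w s d} → Twins w s s → move (output s) ≡ just d →
                  marked s (link x d) ≡ false → neighbour x d ≡ b →
                  position (self (soloMove s)) ≢ b →
                  position (self (soloMove s)) ≢ x →
                  Alone (moveAgents w) (soloMove s)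
    twins-split {w} {s} {d} tw go free fatal safe apart′ = record
      { agent0   = dies
      ; agent1   = trans (cong (_>>= _) agent1)
                         (moveAlong-safe (self s) (move (output s)) marked≡ safe)
      ; apart    = apart′
      ; tokens≡  = tokens≡
      ; marked≡  = marked≡
      }
      where
      open Twins tw
      dies : agents (moveAgents w) 0F ≡ nothing
      dies rewrite agent0 | go | marked≡ (link x d) | free
                 | dec-true (neighbour x d ≟ⁿ b) fatal = refl

    alone-move : ∀ {w s} → Alone w s →
                 position (self (soloMove s)) ≢ b →
                 position (self (soloMove s)) ≢ x →
                 Alone (moveAgents w) (soloMove s)
    alone-move {w} {s} al safe apart′ = record
      { agent0   = cong (_>>= _) agent0
      ; agent1   = trans (cong (_>>= _) agent1)
                         (moveAlong-safe (self s) (move (output s)) marked≡ safe)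
      ; apart    = apart′
      ; tokens≡  = tokens≡
      ; marked≡  = marked≡
      }
      where open Alone al

    alone-dies : ∀ {w s} → Alone w s → position (self s) ≢ b →
                 position (self (soloMove s)) ≡ b → Dead (moveAgents w)
    alone-dies {w} {s} al outside hit = record
      { agent0 = cong (_>>= _) agent0
      ; agent1 = trans (cong (_>>= _) agent1)
                       (moveAlong-fatal (self s) (move (output s)) marked≡ outside hit)
      }
      where open Alone al

    -- Isolates the two inputs in which the displaced copy could differ; arrival and load agree
    -- because `ghost` alters only the position.
    perceived : Agent State n m → ℕ → Bool → Input
    perceived a h c = record
      { arrival = entry a ; tokensAtNode = h ; tokensCarried = carried a ; company = c }

    sense-just : ∀ {w i a} → agents w i ≡ just a →
                 agents (sense w) i ≡ just (record a { memory = δ (memory a) (input w i a) })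
    sense-just eq = cong (Maybe.map _) eq

    -- Indistinguishability: the pile at `x` mirrors the solo pile, and agents at different nodes do
    -- not see each other, so both read the solo input.
    twins-sense : ∀ {w s} → Twins w s s → Twins (sense w) (soloSense s) (soloSense s)
    twins-sense {w} {s} tw = record
      { agent0   = trans (sense-just {w} {0F} agent0) (cong (just ∘ with-input) input0)
      ; agent1   = trans (sense-just {w} {1F} agent1) (cong (just ∘ with-input′) input1)
      ; apart    = apart
      ; tokensAt = tokensAt
      ; tokens≡  = tokens≡
      ; marked≡  = marked≡
      }
      where
      open Twins tw
      a = self s
      with-input with-input′ : Input → Agent State n m
      with-input  i = record (ghost a) { memory = δ (memory a) i }
      with-input′ i = record a { memory = δ (memory a) i }
      input0 : input w 0F (ghost a) ≡ soloInput s
      input0 = cong₂ (perceived a) tokensAt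
        (trans (cong (isAt x) agent1) (dec-false (position a ≟ⁿ x) apart))
      input1 : input w 1F a ≡ soloInput s
      input1 = cong₂ (perceived a) (tokens≡ (position a) apart)
        (trans (cong (isAt (position a)) agent0) (dec-false (x ≟ⁿ position a) (≢-sym apart)))

    alone-sense : ∀ {w s} → Alone w s → Alone (sense w) (soloSense s)
    alone-sense {w} {s} al = record
      { agent0   = cong (Maybe.map _) agent0
      ; agent1   = trans (sense-just {w} {1F} agent1) (cong (just ∘ with-input) input1)
      ; apart    = apart
      ; tokens≡  = tokens≡
      ; marked≡  = marked≡
      }
      where
      open Alone al
      a = self s
      with-input : Input → Agent State n m
      with-input i = record a { memory = δ (memory a) i }
      input1 : input w 1F a ≡ soloInput s
      input1 = cong₂ (perceived a) (tokens≡ (position a) apart)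
        (cong (isAt (position a)) agent0)

    dead-sense : ∀ {w} → Dead w → Dead (sense w)
    dead-sense dw = record
      { agent0 = cong (Maybe.map _) (Dead.agent0 dw)
      ; agent1 = cong (Maybe.map _) (Dead.agent1 dw)
      }

    -- The coupling over whole time units.

    twins-quiet : ∀ {w s} → Twins w s s → Quiet s → Twins (step w) (soloStep s) (soloStep s)
    twins-quiet {w} tw (silent , still) =
      twins-sense (twins-rest (twins-mark (twins-use (first w) tw) silent) still)

    twins-step : ∀ {w s d} → Twins w s s →
                 mark (output s) ≡ nothing → move (output s) ≡ just d →
                 marked s (link x d) ≡ false → neighbour x d ≡ b →
                 position (self (soloStep s)) ≢ b →
                 position (self (soloStep s)) ≢ x →
                 Alone (step w) (soloStep s)
    twins-step {w} {s} {d} tw silent go free fatal safe apart′ =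
      alone-sense (twins-split (twins-mark (twins-use (first w) tw) silent) go
                               free′ fatal safe apart′)
      where
      free′ : marked (soloMark (soloTokens s)) (link x d) ≡ false
      -- The marking phase precedes the move, but a silent agent adds no mark that could close the
      -- fatal link.
      free′ rewrite free | silent = refl

    alone-step : ∀ {w s} → Alone w s →
                 position (self (soloStep s)) ≢ b →
                 position (self (soloStep s)) ≢ x →
                 Alone (step w) (soloStep s)
    alone-step {w} al safe apart′ =
      alone-sense (alone-move (alone-mark (alone-use (first w) al)) safe apart′)

    alone-step-dies : ∀ {w s} → Alone w s → position (self s) ≢ b →
                      position (self (soloStep s)) ≡ b → Dead (step w)
    alone-step-dies {w} al outside hit =
      dead-sense (alone-dies (alone-mark (alone-use (first w) al)) outside hit)

    dead-use : ∀ i {w} → Dead w → Dead (useTokens i w)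
    dead-use 0F {w} dw rewrite useTokens-nothing {w} {0F} (Dead.agent0 dw) = dw
    dead-use 1F {w} dw rewrite useTokens-nothing {w} {1F} (Dead.agent1 dw) = dw

    dead-move : ∀ {w} → Dead w → Dead (moveAgents (markLinks w))
    dead-move {w} dw = record
      { agent0 = gone (Dead.agent0 dw) ; agent1 = gone (Dead.agent1 dw) }
      where
      gone : ∀ {i} → agents w i ≡ nothing → agents (moveAgents (markLinks w)) i ≡ nothing
      gone eq rewrite eq = refl

    dead-step : ∀ {w} → Dead w → Dead (step w)
    dead-step {w} dw = dead-sense (dead-move (dead-use (opposite (first w)) (dead-use (first w) dw)))

    -- Agent 1 stands where the solo agent stands, and its mark alone makes the disjunction true,
    -- whatever agent 0 marks.
    twins-marks : ∀ {w s d} → Twins w s s → mark (output s) ≡ just d →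
                  markedʷ (step w) (link (position (self s)) d) ≡ true
    twins-marks {w} {s} {d} tw stray = begin
      markedʷ w′ e ∨ marks (agents w′ 0F) e ∨ marks (agents w′ 1F) e
        ≡⟨ cong (λ z → markedʷ w′ e ∨ marks (agents w′ 0F) e ∨ z) marks1 ⟩
      markedʷ w′ e ∨ marks (agents w′ 0F) e ∨ true
        ≡⟨ cong (markedʷ w′ e ∨_) (∨-zeroʳ (marks (agents w′ 0F) e)) ⟩
      markedʷ w′ e ∨ true
        ≡⟨ ∨-zeroʳ (markedʷ w′ e) ⟩
      true ∎
      where
      open ≡-Reasoning
      e = link (position (self s)) d
      w′ = useTokens (opposite (first w)) (useTokens (first w) w)
      marks1 : marks (agents w′ 1F) e ≡ true
      marks1 rewrite Twins.agent1 (twins-use (first w) tw) | stray = dec-true (e ≟ˡ e) refl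

    dead-stays : ∀ p T k → Dead (world p T) → Dead (world p (k + T))
    dead-stays p T zero    dw = dw
    dead-stays p T (suc k) dw = dead-step (dead-stays p T k dw)

    -- Obstructions to a solution.

    dead-unsolved : ∀ {w} → Dead w → ¬ Solved w
    dead-unsolved dw (_ , 0F , alive) with () ← subst Is-just (Dead.agent0 dw) alive
    dead-unsolved dw (_ , 1F , alive) with () ← subst Is-just (Dead.agent1 dw) alive

    unmarked-unsolved : ∀ {w} d → markedʷ w (link b d) ≡ false → ¬ Solved w
    unmarked-unsolved d unmarked (exact , _)
      with () ← trans (sym unmarked) (Equivalence.from (exact (link b d)) (d , refl))

    stray-unsolved : ∀ {w e} → markedʷ w e ≡ true → (∀ d → e ≢ link b d) → ¬ Solved w
    stray-unsolved {e = e} stray away (exact , _)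
      with d , eq ← Equivalence.to (exact e) stray = away d eq

    -- The waiting period before the first mark or move.

    module _ (o : Node n m) (o≢x : o ≢ x) (x≢b : x ≢ b) (o≢b : o ≢ b) where

      placement : Placement n m b
      placement = record
        { home      = λ { 0F → x ; 1F → o }
        ; scattered = ≢-sym o≢x
        ; safe      = λ { 0F → x≢b ; 1F → o≢b }
        }

      -- The absence of marks serves twice: no solution has been reached yet, and the link from `x`
      -- into `b` is still open when the first move comes.
      record Waiting (T : ℕ) : Set ℓ where
        field
          twins    : Twins (world placement T) (solo o T) (solo o T)
          home     : position (self (solo o T)) ≡ o
          unmarked : ∀ e → marked (solo o T) e ≡ false

      waiting : ∀ T → (∀ {k} → k < T → Quiet (solo o k)) → Waiting T
      waiting zero _ = record
        { twins = record
          { agent0 = refl ; agent1 = refl ; apart = o≢x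
          ; tokensAt = refl ; tokens≡ = λ _ _ → refl ; marked≡ = λ _ → refl }
        ; home = refl
        ; unmarked = λ _ → refl
        }
      waiting (suc T) quiet = record
        { twins    = twins-quiet twins now
        ; home     = trans (cong (λ d → position (stride (marked (soloMark (soloTokens s))) (self (soloTokens s)) d))
                              (proj₂ now)) home
        ; unmarked = silent
        }
        where
        s = solo o T
        now = quiet ≤-refl
        open Waiting (waiting T (λ k<T → quiet (m<n⇒m<1+n k<T)))
        silent : ∀ e → marked (soloStep s) e ≡ false
        silent e rewrite unmarked e | proj₁ now = refl

      waiting-unsolved : ∀ {T} → Waiting T → ¬ Solved (world placement T)
      -- Any link at `b` would do in place of the northern one, as nothing is marked.
      waiting-unsolved {T} wt = unmarked-unsolved {w = world placement T} north
        (trans (Twins.marked≡ twins (link b north)) (unmarked (link b north)))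
        where open Waiting wt

-- Choice of the black hole from the solo walk.

module Chase {n m t : ℕ} (A : Algorithm ℓ) (first : TieBreak A (2 + n) (2 + m)) where
  open SoloRun {n = 2 + n} {m = 2 + m} t A
  open Agent
  open Solo
  open Output
  open World using () renaming (marked to markedʷ)

  walk : ℕ → Solo (Algorithm.State A) (2 + n) (2 + m)
  walk = solo origin

  place : ℕ → Node (2 + n) (2 + m)
  place T = position (self (walk T))

  Unsolvable : Set ℓ
  Unsolvable = Σ[ b ∈ Node (2 + n) (2 + m) ] Σ[ p ∈ Placement (2 + n) (2 + m) b ]
    ¬ SolvedFrom t A first b p

  Acts : Set
  Acts = ∃[ T ] ¬ Quiet (walk T)

  Reaches : Direction → Set
  Reaches d = ∃[ T ] OnRing d (place T)

  -- The origin and the corner have no incident link in common, so every mark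
  -- made at the origin is wrong for a black hole at the corner.
  module Diagonal where
    -- Home of agent 0, distinct from both `origin` and `corner`.
    side : Node (2 + n) (2 + m)
    side = 1F , 0F

    open Shadow first corner side

    open Execution t A first corner using (world; Solved)

    waiting-at-origin : ∀ T → (∀ {k} → k < T → Quiet (walk k)) →
                        Waiting origin (λ ()) (λ ()) (λ ()) T
    waiting-at-origin = waiting origin (λ ()) (λ ()) (λ ())

    idle-unsolvable : ¬ Acts → Unsolvable
    idle-unsolvable idle = corner , placement origin (λ ()) (λ ()) (λ ()) , λ (T , solved) →
      waiting-unsolved origin _ _ _
        (waiting-at-origin T λ {k} _ → decidable-stable (quiet? (walk k)) (λ loud → idle (k , loud)))
        solved

    -- Up to time `T` nothing is marked; afterwards a wrong mark is present, and marks are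
    -- permanent.
    stray-unsolvable : ∀ T {d} → (∀ {k} → k < T → Quiet (walk k)) →
                       mark (output (walk T)) ≡ just d → Unsolvable
    stray-unsolvable T {d} quiet stray = corner , p , λ (T′ , solved) →
      [ (λ T′≤T → waiting-unsolved origin _ _ _
                    (waiting-at-origin T′ λ k<T′ → quiet (≤-trans k<T′ T′≤T)) solved)
      , (λ T<T′ → late (T′ ∸ suc T) (subst (Solved ∘ world p) (sym (m∸n+n≡m T<T′)) solved))
      ]′ (≤-<-connex T′ T)
      where
      p = placement origin (λ ()) (λ ()) (λ ())
      open Waiting (waiting-at-origin T quiet)
      away : ∀ e → link (place T) d ≢ link corner e
      away e rewrite home with link-aligned origin corner d e
      ... | aligned = λ eq → [ (λ ()) , (λ ()) ]′ (aligned eq)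
      late : ∀ k → ¬ Solved (world p (k + suc T))
      late k = stray-unsolved {w = world p (k + suc T)}
        (marked-stays p (suc T) k _ (twins-marks twins stray)) away

  -- A first act that moves without marking.

  module Departure (T₀ : ℕ) (d : Direction)
                   (quiet : ∀ {k} → k < T₀ → Quiet (walk k))
                   (silent : mark (output (walk T₀)) ≡ nothing)
                   (go : move (output (walk T₀)) ≡ just d) where

    OffUntil : ℕ → Set
    OffUntil T = ∀ {k} → k ≤ T → ¬ OnRing d (place k)

    module Trap (b : Node (2 + n) (2 + m)) (b-on : OnRing d b) where
      x : Node (2 + n) (2 + m)
      x = neighbour b (reverse d)

      x-on : OnRing d x
      x-on = reverse-onRing d b b-on

      open Shadow first b x
      open Execution t A first b using (world; Solved)

      apart : ∀ {u v : Node (2 + n) (2 + m)} → OnRing d v → ¬ OnRing d u → u ≢ v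
      apart on off refl = off on

      origin≢x : origin ≢ x
      origin≢x = apart x-on (origin-offRing d)

      x≢b : x ≢ b
      x≢b = neighbour≢ b (reverse d)

      origin≢b : origin ≢ b
      origin≢b = apart b-on (origin-offRing d)

      p : Placement (2 + n) (2 + m) b
      p = placement origin origin≢x x≢b origin≢b

      Waits : ℕ → Set ℓ
      Waits = Waiting origin origin≢x x≢b origin≢b

      waits : ∀ T → T ≤ T₀ → Waits T
      waits T T≤T₀ = waiting origin origin≢x x≢b origin≢b T
        (λ k<T → quiet (≤-trans k<T T≤T₀))

      data Status (T : ℕ) : Set ℓ where
        before : T ≤ T₀ → Status T
        after  : T₀ < T → Alone (world p T) (walk T) → Status T

      -- Both `b` and `x` lie on the ring, so staying off it provides the two side conditions of the
      -- coupling: not entering `b` and not visiting `x`.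
      status : ∀ T → OffUntil T → Status T
      status zero    _   = before z≤n
      status (suc T) off with status T (λ k≤T → off (≤-trans k≤T (n≤1+n T)))
      ... | after T₀<T alone = after (m<n⇒m<1+n T₀<T)
        (alone-step alone (apart b-on (off ≤-refl)) (apart x-on (off ≤-refl)))
      ... | before T≤T₀ with m≤n⇒m<n∨m≡n T≤T₀
      ...   | inj₁ T<T₀ = before T<T₀
      -- At `T₀` both agents take their first move: the one at `x` enters `b`, the other stays off
      -- the ring.
      ...   | inj₂ refl = after ≤-refl
        (twins-step twins silent go (unmarked _) (neighbour-reverse b d)
                    (apart b-on (off ≤-refl)) (apart x-on (off ≤-refl)))
        where open Waiting (waits T ≤-refl)

      -- After departure the walker is free to mark, but only links at its current node, and no node
      -- off the ring is an end of this link.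
      ring-unmarked : ∀ T → OffUntil T → marked (walk T) (link b d) ≡ false
      ring-unmarked zero    _   = refl
      ring-unmarked (suc T) off = unmarked-step (walk T) (link b d)
        (λ e eq → off (n≤1+n T) (link-onRing d e (place T) b eq b-on))
        (ring-unmarked T (λ k≤T → off (≤-trans k≤T (n≤1+n T))))

      off-unsolved : ∀ T → OffUntil T → ¬ Solved (world p T)
      off-unsolved T off with status T off
      ... | before T≤T₀   = waiting-unsolved origin origin≢x x≢b origin≢b (waits T T≤T₀)
      ... | after _ alone = unmarked-unsolved {w = world p T} d
        (trans (Alone.marked≡ alone (link b d)) (ring-unmarked T off))

      -- Only entry after `T₀` is possible: before that the agent is still at home, and its first
      -- move keeps it off the ring.
      trapped : ∀ T → OffUntil T → place (suc T) ≡ b → Dead (world p (suc T))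
      trapped T off hit with status T off
      ... | after _ alone = alone-step-dies alone (apart b-on (off ≤-refl)) hit
      ... | before T≤T₀ with m≤n⇒m<n∨m≡n T≤T₀
      ...   | inj₁ T<T₀ = ⊥-elim (origin≢b (trans (sym home) hit))
        where open Waiting (waits (suc T) T<T₀)
      ...   | inj₂ refl = ⊥-elim (apart b-on (neighbour-offRing d (place T) (off ≤-refl))
                                   (trans (sym (departs (walk T) silent go (unmarked _))) hit))
        where open Waiting (waits T ≤-refl)

      -- Up to `T` the link at `b` in direction `d` is unmarked; from `suc T` on both agents are
      -- dead.
      trapped-unsolved : ∀ T → OffUntil T → place (suc T) ≡ b → ∀ T′ → ¬ Solved (world p T′)
      trapped-unsolved T off hit T′ =
        [ (λ T′≤T → off-unsolved T′ (λ k≤T′ → off (≤-trans k≤T′ T′≤T)))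
        , (λ T<T′ → subst (¬_ ∘ Solved ∘ world p) (m∸n+n≡m T<T′) (late (T′ ∸ suc T)))
        ]′ (≤-<-connex T′ T)
        where
        late : ∀ k → ¬ Solved (world p (k + suc T))
        late k = dead-unsolved {w = world p (k + suc T)}
          (dead-stays p (suc T) k (trapped T off hit))

    -- The solo walk does not depend on `b`, so choosing `b` from the walk is not circular. If the
    -- ring is never entered, any node on it serves; `corner` is taken.
    ring-unsolvable : Dec (Reaches d) → Unsolvable
    ring-unsolvable (no avoids) = corner , p , λ (T , solved) →
      off-unsolved T (λ {k} _ on → avoids (k , on)) solved
      where open Trap corner (corner-onRing d)
    ring-unsolvable (yes (K , on)) with least (λ T → onRing? d (place T)) {K} on
    ... | zero  , on′ , _   = ⊥-elim (origin-offRing d on′)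
    -- `b` is the first ring node visited, so the arrival equation is `refl`.
    ... | suc T , on′ , off = place (suc T) , p , λ (T′ , solved) →
      trapped-unsolved T (λ k≤T → off (s≤s k≤T)) refl T′ solved
      where open Trap (place (suc T)) on′

  -- Entering the ring concerns the whole infinite walk, so that decision is left as an argument; an
  -- act that includes a mark needs no such decision.
  acting-unsolvable : Acts → Unsolvable ⊎ ∃[ d ] (Dec (Reaches d) → Unsolvable)
  acting-unsolvable (K , loud) with least (λ T → ¬? (quiet? (walk T))) {K} loud
  -- Here `first` is the minimality of `T` and shadows the tie break.
  ... | T , loudT , first with mark (output (walk T)) in marking | move (output (walk T)) in moving
  ...   | nothing | nothing = ⊥-elim (loudT (refl , refl))
  ...   | nothing | just d  = inj₂ (d , Departure.ring-unsolvable T d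
            (λ {k} k<T → decidable-stable (quiet? (walk k)) (first k<T)) marking moving)
  ...   | just d  | _       = inj₁ (Diagonal.stray-unsolvable T
            (λ {k} k<T → decidable-stable (quiet? (walk k)) (first k<T)) marking)

  -- The two undecided questions: does the walk act, and does it enter the ring?

  ¬¬unsolvable : ¬ ¬ Unsolvable
  ¬¬unsolvable none = ¬¬-excluded-middle λ
    { (no idle)  → none (Diagonal.idle-unsolvable idle)
    ; (yes acts) → [ none , (λ (d , settle) → ¬¬-excluded-middle (none ∘ settle)) ]′
                     (acting-unsolvable acts)
    }

  -- Both questions live in `Set`, hence the lift to level `ℓ`.
  classically-unsolvable : ExcludedMiddle ℓ → Unsolvable
  classically-unsolvable em = by-cases decide
    where
    decide : ∀ {P : Set} → Dec P
    decide {P} = map′ lower lift (em {Lift ℓ P})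
    by-cases : Dec Acts → Unsolvable
    by-cases (no idle)  = Diagonal.idle-unsolvable idle
    by-cases (yes acts) =
      [ id , (λ (d , settle) → settle decide) ]′ (acting-unsolvable acts)

lemma3p1 : ∀ {ℓ : Level} (n m t : ℕ) → 3 ≤ n → 3 ≤ m →
    (A : Algorithm ℓ) (first : TieBreak A n m) →
    ¬ SolvesBHS n m t A first
    × (ExcludedMiddle ℓ →
    Σ[ blackHole ∈ Node n m ] Σ[ p ∈ Placement n m blackHole ]
    ¬ SolvedFrom t A first blackHole p)
lemma3p1 n m t (s≤s (s≤s _)) (s≤s (s≤s _)) A first =
    -- Refuting a universal claim needs its counterexample only under double negation; an explicit
    -- one is produced from excluded middle.
    (λ solve → ¬¬unsolvable λ (b , p , unsolved) → unsolved (solve b p))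
  , classically-unsolvable
  where open Chase {t = t} A first
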